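{- For every $k\ge 2$, any deterministic $k$-way branching program computing $\mathrm{Children}^4_2(k)$ has at least $k^4/2$ states.
   Context: $T^4_2$ is the balanced rooted binary tree with 4 levels, nodes numbered heap-style: root $1$, children of $i$ are $2i,2i+1$. An input of $\mathrm{Children}^4_2(k)$ assigns to each internal node $i\neq 1$ a function $f_i:[k]^2\to[k]$ (given by its $k^2$ values, each a $k$-ary input variable $f_i(a,b)$) and to each leaf an element of $[k]=\{1,\dots,k\}$ (one variable each); there is no root function. Values: $v_i$ is the leaf label for a leaf and $v_i=f_i(v_{2i},v_{2i+1})$ for $i\in\{2,\dots,7\}$. The output is the pair $(v_2,v_3)\in[k]^2$. A deterministic $k$-way branching program computing $g:[k]^m\to R$ is a directed rooted multigraph of states; each nonfinal state is labelled by a variable index and has exactly $k$ outedges labelled $1,\dots,k$; $|R|$ final sink states are labelled by elements of $R$; on input $x$ the computation starts at the root, follows from a state labelled $j$ the edge labelled $x_j$, and must reach the final state labelled $g(x)$. -}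

module Defs where

open import Data.Nat using (ℕ; zero; suc)
open import Data.Fin using (Fin)
open import Data.Product using (_×_; _,_; ∃)
open import Relation.Binary.PropositionalEquality using (_≡_)

data Node (V : Set) (k : ℕ) (R : Set) (S : Set) : Set where
  final : R → Node V k R S
  query : V → (Fin k → S) → Node V k R S

record BranchingProgram (V : Set) (k : ℕ) (R : Set) : Set where
  field
    nStates : ℕ
    root    : Fin nStates
    node    : Fin nStates → Node V k R (Fin nStates)
    finalExists : (r : R) → ∃ λ s → node s ≡ final r
    finalUnique : (r : R) (s t : Fin nStates) →
                  node s ≡ final r → node t ≡ final r → s ≡ t

module _ {V : Set} {k : ℕ} {R : Set} where
  open BranchingProgram

  step : (P : BranchingProgram V k R) → (V → Fin k) →
         Fin (nStates P) → Fin (nStates P)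
  step P x s with node P s
  ... | final _      = s
  ... | query j next = next (x j)

  run : (P : BranchingProgram V k R) → (V → Fin k) → ℕ →
        Fin (nStates P) → Fin (nStates P)
  run P x zero    s = s
  run P x (suc t) s = run P x t (step P x s)

  Computes : BranchingProgram V k R → ((V → Fin k) → R) → Set
  Computes P g = (x : V → Fin k) →
                 ∃ λ t → node P (run P x t (root P)) ≡ final (g x)

-- Children^4_2(k) on the tree T^4_2 with heap numbering 1..15.

-- internal nodes other than the root
data Internal : Set where
  n2 n3 n4 n5 n6 n7 : Internal

data Leaf : Set where
  l8 l9 l10 l11 l12 l13 l14 l15 : Leaf

-- input variables: f_i(a,b) for internal i ≠ 1 and a,b ∈ [k]; one per leaf
data ChVar (k : ℕ) : Set where
  fvar : Internal → Fin k → Fin k → ChVar k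
  lvar : Leaf → ChVar k

module _ {k : ℕ} (x : ChVar k → Fin k) where
  private
    f : Internal → Fin k → Fin k → Fin k
    f i a b = x (fvar i a b)
    ℓ : Leaf → Fin k
    ℓ j = x (lvar j)

  v4 v5 v6 v7 v2 v3 : Fin k
  v4 = f n4 (ℓ l8)  (ℓ l9)
  v5 = f n5 (ℓ l10) (ℓ l11)
  v6 = f n6 (ℓ l12) (ℓ l13)
  v7 = f n7 (ℓ l14) (ℓ l15)
  v2 = f n2 v4 v5
  v3 = f n3 v6 v7

Children : (k : ℕ) → (ChVar k → Fin k) → Fin k × Fin k
Children k x = v2 x , v3 x

{-# OPTIONS --safe #-}
-- Restrict to inputs where f₂ = f₃ = addition mod k and each of f₄,…,f₇ vanishes
-- except possibly at its "thrifty" argument pair, the labels of the two leaves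
-- below it.  Such an input is given by 12 free values: the 8 leaves and v₄,…,v₇.
-- Every computation makes a thrifty query, since otherwise v₄ could be changed
-- unnoticed.  Consider the state γ making the last one, to node i say.  Its
-- variable names the two leaves below i, and given the other 6 leaves and vᵢ the
-- computation from γ onwards is determined, hence so are v₂ = v₄ + v₅ and
-- v₃ = v₆ + v₇.  One more value on the side not containing i then fixes the
-- input.  So each γ serves at most k⁸ of the k¹² inputs, and there are at least
-- k⁴ states.
module Submission where

open import Defs
open import Data.Nat using (ℕ; zero; suc; _≤_; _+_; _*_; _∸_; _^_; _%_; NonZero; z≤n; s≤s)
open import Data.Nat.Properties using (+-comm; +-assoc; m∸n+n≡m; <⇒≤; ≤-trans; m≤m+n; *-cancelʳ-≤; ^-distribˡ-+-*; m^n≢0)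
open import Data.Nat.DivMod using (_mod_; %-distribˡ-+; m<n⇒m%n≡m; [m+n]%n≡m%n; m%n%n≡m%n; m%n<n)
open import Data.Fin using (Fin; toℕ; combine; finToFun; funToFin; punchIn; quotient; remainder; _≟_)
open import Data.Fin.Patterns using (0F; 1F; 2F; 3F; 4F; 5F; 6F; 7F)
open import Data.Fin.Properties using (toℕ-fromℕ<; toℕ-injective; toℕ<n; combine-injective; combine-remQuot; finToFun-funToFin; funToFin-finToFin; injective⇒≤; punchInᵢ≢i)
open import Data.Product using (_×_; _,_; ∃; proj₁; proj₂)
open import Data.Sum using (_⊎_; inj₁; inj₂)
open import Data.Unit using (tt)
open import Data.Vec using (Vec; []; _∷_; lookup)
open import Data.Vec.Functional using (updateAt)
open import Function using (_∘_)
open import Function.Definitions using (Injective)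
open import Level using (0ℓ)
open import Relation.Binary.PropositionalEquality using (_≡_; _≗_; refl; sym; trans; cong; cong₂; subst; module ≡-Reasoning)
open import Relation.Nullary using (¬_; Dec; yes; no; contradiction)
open import Relation.Nullary.Decidable using (_×-dec_; map′)
open import Relation.Unary using (Pred; Decidable; U; ∁)

-- Computations as inductive runs, and their last query to a set of variables

module Computation {V : Set} {k : ℕ} {R : Set} (P : BranchingProgram V k R) where
  open BranchingProgram P

  -- `A` constrains every variable queried along the way; `A = U` gives an arbitrary terminating
  -- computation.
  data Run (A : Pred V 0ℓ) (x : V → Fin k) : Fin nStates → R → Set where
    stop : ∀ {s r} → node s ≡ final r → Run A x s r
    ask  : ∀ {s r j next} → node s ≡ query j next → A j →
           Run A x (next (x j)) r → Run A x s r

  run⇒Run : ∀ {x r} t s → node (run P x t s) ≡ final r → Run U x s r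
  run⇒Run zero s p = stop p
  run⇒Run {x} (suc t) s p with node s in eq | run⇒Run t (step P x s) p
  -- `step` fixes a final state, so the recursive result is already a run from `s`.
  ... | final _   | ρ = ρ
  ... | query _ _ | ρ = ask eq tt ρ

  weaken : ∀ {A x s r} → Run A x s r → Run U x s r
  weaken (stop p)    = stop p
  weaken (ask p _ ρ) = ask p tt (weaken ρ)

  -- Only the first run is confined to `A`: since `x` and `y` agree there, the second run is forced
  -- along the same edges.
  sameOutput : ∀ {A x y s r r′} → (∀ {j} → A j → x j ≡ y j) →
               Run A x s r → Run U y s r′ → r ≡ r′
  sameOutput x≈y (stop p) (stop q) with refl ← trans (sym p) q = refl
  sameOutput x≈y (stop p) (ask q _ _) with () ← trans (sym p) q
  sameOutput x≈y (ask p _ _) (stop q) with () ← trans (sym p) q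
  sameOutput {y = y} {r′ = r′} x≈y (ask p a ρ) (ask {next = next} q _ σ)
    with refl ← trans (sym p) q =
    sameOutput x≈y ρ (subst (λ v → Run U y (next v) r′) (sym (x≈y a)) σ)

  record LastQuery (T : Pred V 0ℓ) (x : V → Fin k) (r : R) : Set where
    field
      state    : Fin nStates
      asked    : V
      next     : Fin k → Fin nStates
      queries  : node state ≡ query asked next
      hit      : T asked
      rest     : Run (∁ T) x (next (x asked)) r

  -- The tail is searched first, so a query is recorded only when no later one lies in `T`.
  lastQuery : ∀ {T x s r} → Decidable T → Run U x s r →
              Run (∁ T) x s r ⊎ LastQuery T x r
  lastQuery T? (stop p) = inj₁ (stop p)
  lastQuery T? (ask {j = j} p _ ρ) with lastQuery T? ρ | T? j
  ... | inj₂ q | _      = inj₂ q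
  ... | inj₁ σ | no ¬Tj = inj₁ (ask p ¬Tj σ)
  ... | inj₁ σ | yes Tj = inj₂ record { queries = p ; hit = Tj ; rest = σ }

-- Addition modulo `n` and its cancellation

module _ {n : ℕ} .{{_ : NonZero n}} where

  infixl 6 _⊕_
  _⊕_ : Fin n → Fin n → Fin n
  a ⊕ b = (toℕ a + toℕ b) mod n

  ⊕-comm : ∀ a b → a ⊕ b ≡ b ⊕ a
  ⊕-comm a b = cong (_mod n) (+-comm (toℕ a) (toℕ b))

  toℕ-⊕ : ∀ a b → toℕ (a ⊕ b) ≡ (toℕ a + toℕ b) % n
  toℕ-⊕ a b = toℕ-fromℕ< (m%n<n (toℕ a + toℕ b) n)

  -- Adding `n ∸ toℕ a` subtracts `a` modulo `n`; the truncated difference is exact because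
  -- `toℕ a < n`.
  ⊕-recoverʳ : ∀ a b → (n ∸ toℕ a + toℕ (a ⊕ b)) % n ≡ toℕ b
  ⊕-recoverʳ a b = begin
    (d + toℕ (a ⊕ b)) % n             ≡⟨ cong (λ z → (d + z) % n) (toℕ-⊕ a b) ⟩
    (d + s % n) % n                   ≡⟨ %-distribˡ-+ d (s % n) n ⟩
    (d % n + s % n % n) % n           ≡⟨ cong (λ z → (d % n + z) % n) (m%n%n≡m%n s n) ⟩
    (d % n + s % n) % n               ≡⟨ %-distribˡ-+ d s n ⟨
    (d + (toℕ a + toℕ b)) % n         ≡⟨ cong (_% n) (+-assoc d (toℕ a) (toℕ b)) ⟨
    (d + toℕ a + toℕ b) % n           ≡⟨ cong (λ z → (z + toℕ b) % n) (m∸n+n≡m (<⇒≤ (toℕ<n a))) ⟩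
    (n + toℕ b) % n                   ≡⟨ cong (_% n) (+-comm n (toℕ b)) ⟩
    (toℕ b + n) % n                   ≡⟨ [m+n]%n≡m%n (toℕ b) n ⟩
    toℕ b % n                         ≡⟨ m<n⇒m%n≡m (toℕ<n b) ⟩
    toℕ b                             ∎
    where
    open ≡-Reasoning
    d = n ∸ toℕ a
    s = toℕ a + toℕ b

  ⊕-cancelˡ : ∀ a {b c} → a ⊕ b ≡ a ⊕ c → b ≡ c
  ⊕-cancelˡ a {b} {c} eq = toℕ-injective (begin
    toℕ b                            ≡⟨ ⊕-recoverʳ a b ⟨
    (n ∸ toℕ a + toℕ (a ⊕ b)) % n    ≡⟨ cong (λ z → (n ∸ toℕ a + toℕ z) % n) eq ⟩
    (n ∸ toℕ a + toℕ (a ⊕ c)) % n    ≡⟨ ⊕-recoverʳ a c ⟩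
    toℕ c                            ∎)
    where open ≡-Reasoning

-- Coding functions between finite sets by numbers

funToFin-injective : ∀ {m n} {f g : Fin m → Fin n} → funToFin f ≡ funToFin g → f ≗ g
funToFin-injective {f = f} {g} eq i = trans (sym (finToFun-funToFin f i))
  (trans (cong (λ c → finToFun c i) eq) (finToFun-funToFin g i))

funToFin-cong : ∀ {m n} {f g : Fin m → Fin n} → f ≗ g → funToFin f ≡ funToFin g
funToFin-cong {zero}  _   = refl
funToFin-cong {suc m} f≗g = cong₂ combine (f≗g 0F) (funToFin-cong (f≗g ∘ Fin.suc))

finToFun-injective : ∀ {m n} {c d : Fin (n ^ m)} → finToFun {n} {m} c ≗ finToFun d → c ≡ d
finToFun-injective {m} {n} {c} {d} eq = trans (sym (funToFin-finToFin {m} {n} c))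
  (trans (funToFin-cong eq) (funToFin-finToFin {m} {n} d))

-- The nodes 4 to 7 and the twelve coordinates

Bottom : Set
Bottom = Fin 4

internal : Bottom → Internal
internal 0F = n4
internal 1F = n5
internal 2F = n6
internal 3F = n7

internal-injective : ∀ {b c} → internal b ≡ internal c → b ≡ c
internal-injective {b} {c} eq =
  trans (sym (bottom-internal b)) (trans (cong bottom eq) (bottom-internal c))
  where
  bottom : Internal → Bottom
  bottom n5 = 1F
  bottom n6 = 2F
  bottom n7 = 3F
  -- This is the right value for `n4` and a dummy for `n2` and `n3`, which `internal` never hits.
  bottom _  = 0F
  bottom-internal : ∀ b → bottom (internal b) ≡ b
  bottom-internal 0F = refl
  bottom-internal 1F = refl
  bottom-internal 2F = refl
  bottom-internal 3F = refl

fvar-injective : ∀ {k i i′} {a a′ c c′ : Fin k} →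
                 fvar i a c ≡ fvar i′ a′ c′ → i ≡ i′ × a ≡ a′ × c ≡ c′
fvar-injective refl = refl , refl , refl

sibling cousin : Bottom → Bottom
sibling 0F = 1F
sibling 1F = 0F
sibling 2F = 3F
sibling 3F = 2F
cousin 0F = 2F
cousin 1F = 3F
cousin 2F = 0F
cousin 3F = 1F

-- Seen from any `b`, the four nodes are `b`, its sibling, and a pair below the other child of the
-- root. Later arguments can thus treat an arbitrary `b` without splitting into cases.
∀-bottom : ∀ {Q : Bottom → Set} b → Q b → Q (sibling b) → Q (cousin b) →
           Q (sibling (cousin b)) → ∀ c → Q c
∀-bottom {Q} = λ where
    0F p q r s → cases p q r s
    1F p q r s → cases q p s r
    2F p q r s → cases r s p q
    3F p q r s → cases s r q p
  where
  cases : Q 0F → Q 1F → Q 2F → Q 3F → ∀ c → Q c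
  cases p q r s 0F = p
  cases p q r s 1F = q
  cases p q r s 2F = r
  cases p q r s 3F = s

Coordinate : Set
Coordinate = Fin (4 * 3)

left right value : Bottom → Coordinate
left  b = combine {4} {3} b 0F
right b = combine {4} {3} b 1F
value b = combine {4} {3} b 2F

∀-coordinate : ∀ {Q : Coordinate → Set} → (∀ b → Q (left b)) → (∀ b → Q (right b)) →
               (∀ b → Q (value b)) → ∀ i → Q i
∀-coordinate {Q} p q r i = subst Q (combine-remQuot {4} 3 i) (cases (quotient {4} 3 i) (remainder {4} 3 i))
  where
  cases : ∀ b c → Q (combine {4} {3} b c)
  cases b 0F = p b
  cases b 1F = q b
  cases b 2F = r b

-- Four coordinates are omitted: the leaves below `b`, which the queried variable names, and the
-- values of two siblings, which the output sums give back.
advice : Bottom → Vec Coordinate 8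
advice b = value b ∷ value (cousin b)
         ∷ left (sibling b) ∷ right (sibling b)
         ∷ left (cousin b) ∷ right (cousin b)
         ∷ left (sibling (cousin b)) ∷ right (sibling (cousin b)) ∷ []

-- The family of hard inputs and their thrifty variables

module HardInputs (k′ : ℕ) where

  private
    k : ℕ
    k = suc (suc k′)

  Assignment : Set
  Assignment = Coordinate → Fin k

  bottomFunction : Assignment → Bottom → Fin k → Fin k → Fin k
  bottomFunction u b a c with a ≟ u (left b) ×-dec c ≟ u (right b)
  ... | yes _ = u (value b)
  ... | no  _ = 0F

  input : Assignment → ChVar k → Fin k
  input u (fvar n2 a c) = a ⊕ c
  input u (fvar n3 a c) = a ⊕ c
  input u (fvar n4 a c) = bottomFunction u 0F a c
  input u (fvar n5 a c) = bottomFunction u 1F a c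
  input u (fvar n6 a c) = bottomFunction u 2F a c
  input u (fvar n7 a c) = bottomFunction u 3F a c
  input u (lvar l8)  = u (left 0F)
  input u (lvar l9)  = u (right 0F)
  input u (lvar l10) = u (left 1F)
  input u (lvar l11) = u (right 1F)
  input u (lvar l12) = u (left 2F)
  input u (lvar l13) = u (right 2F)
  input u (lvar l14) = u (left 3F)
  input u (lvar l15) = u (right 3F)

  thriftyVariable : Assignment → Bottom → ChVar k
  thriftyVariable u b = fvar (internal b) (u (left b)) (u (right b))

  Thrifty : Assignment → Pred (ChVar k) 0ℓ
  Thrifty u j = ∃ λ b → j ≡ thriftyVariable u b

  bottom-thrifty? : ∀ u b a c → Dec (Thrifty u (fvar (internal b) a c))
  bottom-thrifty? u b a c = map′ to from (a ≟ u (left b) ×-dec c ≟ u (right b))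
    where
    to : a ≡ u (left b) × c ≡ u (right b) → Thrifty u (fvar (internal b) a c)
    to (p , q) = b , cong₂ (fvar (internal b)) p q
    from : Thrifty u (fvar (internal b) a c) → a ≡ u (left b) × c ≡ u (right b)
    from (b′ , eq) with p , q , r ← fvar-injective eq
      with refl ← internal-injective {b} {b′} p = q , r

  thrifty? : ∀ u → Decidable (Thrifty u)
  thrifty? u (fvar n2 a c) = no λ where (0F , ()) ; (1F , ()) ; (2F , ()) ; (3F , ())
  thrifty? u (fvar n3 a c) = no λ where (0F , ()) ; (1F , ()) ; (2F , ()) ; (3F , ())
  thrifty? u (fvar n4 a c) = bottom-thrifty? u 0F a c
  thrifty? u (fvar n5 a c) = bottom-thrifty? u 1F a c
  thrifty? u (fvar n6 a c) = bottom-thrifty? u 2F a c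
  thrifty? u (fvar n7 a c) = bottom-thrifty? u 3F a c
  thrifty? u (lvar _) = no λ ()

  bottomFunction-thrifty : ∀ u b → bottomFunction u b (u (left b)) (u (right b)) ≡ u (value b)
  bottomFunction-thrifty u b
    with u (left b) ≟ u (left b) ×-dec u (right b) ≟ u (right b)
  ... | yes _ = refl
  ... | no ¬p = contradiction (refl , refl) ¬p

  input-thrifty : ∀ u b → input u (thriftyVariable u b) ≡ u (value b)
  input-thrifty u 0F = bottomFunction-thrifty u 0F
  input-thrifty u 1F = bottomFunction-thrifty u 1F
  input-thrifty u 2F = bottomFunction-thrifty u 2F
  input-thrifty u 3F = bottomFunction-thrifty u 3F

  Children-input : ∀ u → Children k (input u) ≡
                   (u (value 0F) ⊕ u (value 1F) , u (value 2F) ⊕ u (value 3F))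
  Children-input u = cong₂ _,_
    (cong₂ _⊕_ (input-thrifty u 0F) (input-thrifty u 1F))
    (cong₂ _⊕_ (input-thrifty u 2F) (input-thrifty u 3F))

  SameLeaves : Assignment → Assignment → Bottom → Set
  SameLeaves u w b = u (left b) ≡ w (left b) × u (right b) ≡ w (right b)

  bottomFunction-unthrifty : ∀ {u w} b {a c} → SameLeaves u w b →
    ¬ Thrifty u (fvar (internal b) a c) → bottomFunction u b a c ≡ bottomFunction w b a c
  bottomFunction-unthrifty {u} {w} b {a} {c} (p , q) ¬t
    with a ≟ u (left b) ×-dec c ≟ u (right b) | a ≟ w (left b) ×-dec c ≟ w (right b)
  ... | yes (r , s) | _ = contradiction (b , cong₂ (fvar (internal b)) r s) ¬t
  ... | no ¬rs | yes (r , s) = contradiction (trans r (sym p) , trans s (sym q)) ¬rs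
  ... | no _ | no _ = refl

  -- The coordinates `value b` enter the input only at thrifty variables, and equal leaves put these
  -- at the same places for `u` and `w`.
  input-unthrifty : ∀ {u w} → (∀ b → SameLeaves u w b) →
                    ∀ {j} → ¬ Thrifty u j → input u j ≡ input w j
  input-unthrifty s {fvar n2 a c} _ = refl
  input-unthrifty s {fvar n3 a c} _ = refl
  input-unthrifty s {fvar n4 a c} = bottomFunction-unthrifty 0F (s 0F)
  input-unthrifty s {fvar n5 a c} = bottomFunction-unthrifty 1F (s 1F)
  input-unthrifty s {fvar n6 a c} = bottomFunction-unthrifty 2F (s 2F)
  input-unthrifty s {fvar n7 a c} = bottomFunction-unthrifty 3F (s 3F)
  input-unthrifty s {lvar l8}  _ = proj₁ (s 0F)
  input-unthrifty s {lvar l9}  _ = proj₂ (s 0F)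
  input-unthrifty s {lvar l10} _ = proj₁ (s 1F)
  input-unthrifty s {lvar l11} _ = proj₂ (s 1F)
  input-unthrifty s {lvar l12} _ = proj₁ (s 2F)
  input-unthrifty s {lvar l13} _ = proj₂ (s 2F)
  input-unthrifty s {lvar l14} _ = proj₁ (s 3F)
  input-unthrifty s {lvar l15} _ = proj₂ (s 3F)

  -- Recovering an assignment from leaves, advice and output

  siblingSum : ∀ {u w} → Children k (input u) ≡ Children k (input w) → ∀ b →
               u (value b) ⊕ u (value (sibling b)) ≡ w (value b) ⊕ w (value (sibling b))
  siblingSum {u} {w} eq = λ where
      0F → cong proj₁ sums
      1F → swap 0F 1F (cong proj₁ sums)
      2F → cong proj₂ sums
      3F → swap 2F 3F (cong proj₂ sums)
    where
    sums = trans (sym (Children-input u)) (trans eq (Children-input w))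
    swap : ∀ b c → u (value b) ⊕ u (value c) ≡ w (value b) ⊕ w (value c) →
           u (value c) ⊕ u (value b) ≡ w (value c) ⊕ w (value b)
    swap b c p = trans (⊕-comm (u (value c)) (u (value b)))
      (trans p (⊕-comm (w (value b)) (w (value c))))

  siblingValue : ∀ {u w} → Children k (input u) ≡ Children k (input w) → ∀ b →
                 u (value b) ≡ w (value b) → u (value (sibling b)) ≡ w (value (sibling b))
  siblingValue {u} {w} eq b p = ⊕-cancelˡ (u (value b))
    (trans (siblingSum {u} {w} eq b) (cong (_⊕ w (value (sibling b))) (sym p)))

  SameAdvice : Assignment → Assignment → Bottom → Set
  SameAdvice u w b = ∀ i → u (lookup (advice b) i) ≡ w (lookup (advice b) i)

  allLeaves : ∀ {u w} b → SameLeaves u w b → SameAdvice u w b → ∀ c → SameLeaves u w c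
  allLeaves b s h = ∀-bottom b s (h 2F , h 3F) (h 4F , h 5F) (h 6F , h 7F)

  allCoordinates : ∀ {u w} b → SameLeaves u w b → SameAdvice u w b →
                   Children k (input u) ≡ Children k (input w) → u ≗ w
  allCoordinates {u} {w} b s h eq =
    ∀-coordinate (proj₁ ∘ leaves) (proj₂ ∘ leaves) values
    where
    leaves = allLeaves {u} {w} b s h
    values : ∀ c → u (value c) ≡ w (value c)
    values = ∀-bottom b (h 0F) (siblingValue {u} {w} eq b (h 0F))
                        (h 1F) (siblingValue {u} {w} eq (cousin b) (h 1F))

  -- Critical states and the counting argument

  module LowerBound (P : BranchingProgram (ChVar k) k (Fin k × Fin k))
                    (computes : Computes P (Children k)) where
    open BranchingProgram P
    open Computation P

    computation : ∀ u → Run U (input u) root (Children k (input u))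
    computation u = run⇒Run (proj₁ (computes (input u))) root (proj₂ (computes (input u)))

    -- A run avoiding thrifty variables could not notice a change of `v₄` alone, yet with the value
    -- of node 5 fixed the sum at node 2 determines `v₄`.
    queriesThrifty : ∀ u → ¬ Run (∁ (Thrifty u)) (input u) root (Children k (input u))
    queriesThrifty u ρ = punchInᵢ≢i (u v₄) 0F (sym (siblingValue {u} {w} same 1F refl))
      where
      v₄ = value 0F
      w : Assignment
      -- `punchIn a 0F` is a value other than `a`; it exists because `k` is at least 2.
      w = updateAt u v₄ (λ a → punchIn a 0F)
      sameLeaves : ∀ b → SameLeaves u w b
      sameLeaves 0F = refl , refl
      sameLeaves 1F = refl , refl
      sameLeaves 2F = refl , refl
      sameLeaves 3F = refl , refl
      same : Children k (input u) ≡ Children k (input w)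
      same = sameOutput (input-unthrifty sameLeaves) ρ (computation w)

    critical : ∀ u → LastQuery (Thrifty u) (input u) (Children k (input u))
    critical u with lastQuery (thrifty? u) (computation u)
    ... | inj₁ ρ = contradiction ρ (queriesThrifty u)
    ... | inj₂ q = q

    module Critical (u : Assignment) where
      open LastQuery (critical u) public
      bottom : Bottom
      bottom = proj₁ hit
      hint : Fin 8 → Fin k
      hint = u ∘ lookup (advice bottom)

    open Critical

    query-injective : ∀ {j j′ : ChVar k} {f f′ : Fin k → Fin nStates} →
                      query {R = Fin k × Fin k} j f ≡ query j′ f′ → j ≡ j′ × f ≡ f′
    query-injective refl = refl , refl

    input-asked : ∀ u → input u (asked u) ≡ u (value (bottom u))
    input-asked u = trans (cong (input u) (proj₂ (hit u))) (input-thrifty u (bottom u))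

    -- Equal critical states ask the same variable, which fixes the node and its two leaves. With
    -- the hints, all leaves and the answer agree, so both computations continue to the same output,
    -- which yields the remaining values.
    determined : ∀ {u w} → state u ≡ state w → hint u ≗ hint w → u ≗ w
    determined {u} {w} sameState sameHint =
      allCoordinates b sameLeaves sameAdvice
        -- Only the rest of the run on `u` has to avoid the thrifty variables of `u`; the run on `w`
        -- follows it.
        (sameOutput (input-unthrifty (allLeaves {u} {w} b sameLeaves sameAdvice))
          (rest u)
          (subst (λ s → Run U (input w) s (Children k (input w))) (sym successor)
            (weaken (rest w))))
      where
      b = bottom u
      labels : asked u ≡ asked w × next u ≡ next w
      labels = query-injective (trans (sym (queries u)) (trans (cong node sameState) (queries w)))
      variables = fvar-injective
        (trans (sym (proj₂ (hit u))) (trans (proj₁ labels) (proj₂ (hit w))))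
      sameBottom : b ≡ bottom w
      sameBottom = internal-injective (proj₁ variables)
      at : (f : Bottom → Coordinate) → ∀ {a} → a ≡ w (f (bottom w)) → a ≡ w (f b)
      at f p = trans p (cong (w ∘ f) (sym sameBottom))
      sameLeaves : SameLeaves u w b
      sameLeaves = at left (proj₁ (proj₂ variables)) , at right (proj₂ (proj₂ variables))
      sameAdvice : SameAdvice u w b
      sameAdvice i = at (λ c → lookup (advice c) i) (sameHint i)
      successor : next u (input u (asked u)) ≡ next w (input w (asked w))
      successor = begin
        next u (input u (asked u))    ≡⟨ cong (next u) (input-asked u) ⟩
        -- Entry `0F` of the advice is the value of the queried node, that is, the answer to the
        -- query.
        next u (u (value b))          ≡⟨ cong (next u) (sameHint 0F) ⟩
        next u (w (value (bottom w))) ≡⟨ cong (next u) (input-asked w) ⟨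
        next u (input w (asked w))    ≡⟨ cong (λ f → f (input w (asked w))) (proj₂ labels) ⟩
        next w (input w (asked w))    ∎
        where open ≡-Reasoning

    encode : Fin (k ^ 12) → Fin (nStates * k ^ 8)
    encode c = combine (state (finToFun c)) (funToFin (hint (finToFun c)))

    encode-injective : Injective _≡_ _≡_ encode
    encode-injective {c} {d} eq =
      finToFun-injective (determined {finToFun c} {finToFun d} (proj₁ parts)
        (funToFin-injective (proj₂ parts)))
      where
      parts = combine-injective (state (finToFun c)) (funToFin (hint (finToFun c)))
                                (state (finToFun d)) (funToFin (hint (finToFun d))) eq

    k⁴≤nStates : k ^ 4 ≤ nStates
    k⁴≤nStates = *-cancelʳ-≤ (k ^ 4) nStates (k ^ 8) {{m^n≢0 k 8}}
      -- Injectivity of `encode` gives `k ^ 12 ≤ nStates * k ^ 8`, and 12 splits as 4 + 8.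
      (subst (_≤ nStates * k ^ 8) (^-distribˡ-+-* k 4 8) (injective⇒≤ encode-injective))

theorem5p8 : (k : ℕ) → 2 ≤ k →
    (P : BranchingProgram (ChVar k) k (Fin k × Fin k)) →
    Computes P (Children k) →
    k ^ 4 ≤ 2 * BranchingProgram.nStates P
theorem5p8 (suc (suc k′)) (s≤s (s≤s z≤n)) P computes =
  ≤-trans (HardInputs.LowerBound.k⁴≤nStates k′ P computes) (m≤m+n _ _)
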